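{- $w^\ast(3,3)\ge 414$. More precisely, the 3-coloring of $\{1,\dots,413\}$ in which the color of $n$ is the $n$-th letter of the following word (the concatenation of the six lines, of lengths $70,70,70,70,70,63$) contains no monochromatic double 3-term arithmetic progression: 0101102210100201200100221221010010220010112011211202210112122112202210 0110010220201122022002202001012212112122001001120121100110020022002110 2001101001121120210020011210201121122112122010110100110102201220201221 1210021122112122112200110011212200202202001212212112212200110010110012 0211212200220100112202200220200122102212211211002101220022001001100221 211010010110020022110010110010221211020220200220221001122011211
   Context: An increasing sequence of positive integers $a_1<a_2<\cdots$ (finite or infinite) contains a double 3-term arithmetic progression if there are indices $i<j<k$ with $i+k=2j$ and $a_i+a_k=2a_j$. For a coloring of an interval, each color class is regarded as an increasing sequence by listing its elements in increasing order; a monochromatic double 3-term arithmetic progression is a double 3-term arithmetic progression in some color class. $w^\ast(r,3)$ denotes the least integer $N$, if it exists, such that every $r$-coloring of $\{1,\dots,N\}$ has a monochromatic double 3-term arithmetic progression; $w^\ast(3,3)\ge414$ means that either it does not exist or it is at least $414$. -}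

module Defs where

open import Data.Char.Base using (Char)
import Data.Char.Properties as Char
open import Data.Fin.Base as Fin using (Fin; toℕ)
open import Data.Fin.Properties using (_≟_)
open import Data.List.Base using (List; []; _∷_; allFin; concat; filter; findIndex; lookup; map)
open import Data.Maybe.Base using (Maybe; just; from-just; zipWith)
open import Data.Nat.Base using (ℕ; suc; _+_; _*_; _≤_)
open import Data.Product.Base using (_×_; ∃-syntax)
open import Data.String.Base using (toList)
open import Relation.Binary.PropositionalEquality.Core using (_≡_)

-- The indices run from 0 instead of 1; the equation i + k = 2j is invariant
-- under this shift.
HasDouble3AP : List ℕ → Set
HasDouble3AP a =
  ∃[ i ] ∃[ j ] ∃[ k ]
    i Fin.< j × j Fin.< k ×
    toℕ i + toℕ k ≡ 2 * toℕ j ×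
    lookup a i + lookup a k ≡ 2 * lookup a j

-- Colorings of {1,…,N}: the index i : Fin N stands for the integer 1 + i.
Coloring : ℕ → ℕ → Set
Coloring r N = Fin N → Fin r

element : ∀ {N} → Fin N → ℕ
element i = suc (toℕ i)

-- allFin lists Fin N in increasing order, hence so does each color class.
colorClass : ∀ {r N} → Coloring r N → Fin r → List ℕ
colorClass {N = N} χ c = map element (filter (λ i → χ i ≟ c) (allFin N))

HasMonochromaticDouble3AP : ∀ {r N} → Coloring r N → Set
HasMonochromaticDouble3AP χ = ∃[ c ] HasDouble3AP (colorClass χ c)

Unavoidable : ℕ → ℕ → Set
Unavoidable r N = (χ : Coloring r N) → HasMonochromaticDouble3AP χ

-- w*[ r ,3]≡ N : the number w*(r,3) exists and equals N.
w*[_,3]≡_ : ℕ → ℕ → Set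
w*[ r ,3]≡ N = Unavoidable r N × (∀ M → Unavoidable r M → N ≤ M)

-- Either w*(r,3) does not exist or it is at least m.
w*[_,3]≥_ : ℕ → ℕ → Set
w*[ r ,3]≥ m = ∀ N → w*[ r ,3]≡ N → m ≤ N

letter : Char → Maybe (Fin 3)
letter c = findIndex (c Char.≟_) (toList "012")

letters : List Char → Maybe (List (Fin 3))
letters []       = just []
letters (c ∷ cs) = zipWith _∷_ (letter c) (letters cs)

word : List (Fin 3)
word = concat
  ( from-just (letters (toList "0101102210100201200100221221010010220010112011211202210112122112202210"))
  ∷ from-just (letters (toList "0110010220201122022002202001012212112122001001120121100110020022002110"))
  ∷ from-just (letters (toList "2001101001121120210020011210201121122112122010110100110102201220201221"))
  ∷ from-just (letters (toList "1210021122112122112200110011212200202202001212212112212200110010110012"))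
  ∷ from-just (letters (toList "0211212200220100112202200220200122102212211211002101220022001001100221"))
  ∷ from-just (letters (toList "211010010110020022110010110010221211020220200220221001122011211"))
  ∷ [])

-- Typechecks because length word evaluates to 413.
wordColoring : Coloring 3 413
wordColoring = lookup word

{-# OPTIONS --safe #-}

-- A finite search over the three color classes of the word shows that none of
-- them contains a double 3-term progression.  Restricting the coloring to {1,…,m}
-- with m ≤ 413 truncates each color class to a prefix and so creates no such
-- progression; hence no m ≤ 413 is unavoidable.

module Submission where

open import Defs
open import Data.Empty using (⊥)
open import Data.Fin.Base using (Fin; zero; suc; toℕ; inject≤)
open import Data.Fin.Properties using (all?; toℕ-inject≤)
open import Data.List.Base using (List; []; _∷_; length; lookup; allFin; tabulate)
open import Data.List.Relation.Binary.Prefix.Heterogeneous as Prefix using (Prefix; []; _∷_)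
open import Data.List.Relation.Binary.Prefix.Heterogeneous.Properties using (map⁺; filter⁺)
open import Data.Nat.Base using (ℕ; suc; _+_; _*_; _≤_; s≤s; s≤s⁻¹)
open import Data.Nat.Properties using (_≟_; *-suc; +-suc; suc-injective; ≮⇒≥)
open import Data.Product.Base using (_×_; _,_)
open import Data.Sum.Base using (_⊎_; inj₁; inj₂)
import Data.Sum.Base as Sum
open import Function.Base using (_∘_; id)
open import Level using (Level)
open import Relation.Binary.Core using (REL)
open import Relation.Binary.PropositionalEquality.Core using (_≡_; refl; sym; trans; cong)
open import Relation.Nullary.Decidable.Core using (Dec; no; _⊎-dec_; ¬?; from-yes)
open import Relation.Nullary.Negation.Core using (¬_)

private
  variable
    a b ℓ : Level
    A : Set a
    B : Set b
    m n r : ℕ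

-- The third list is traversed at twice the speed of the second: started on the
-- same list, this compares x with the entries at distances d and 2d from it.
Completes : ℕ → List ℕ → List ℕ → Set
Completes x (y ∷ ys) (_ ∷ z ∷ zs) = x + z ≡ 2 * y ⊎ Completes x ys zs
Completes _ _        _            = ⊥

completes? : ∀ x ys zs → Dec (Completes x ys zs)
completes? x (y ∷ ys) (_ ∷ z ∷ zs) = (x + z ≟ 2 * y) ⊎-dec completes? x ys zs
completes? _ []       _            = no λ ()
completes? _ (_ ∷ _)  []           = no λ ()
completes? _ (_ ∷ _)  (_ ∷ [])     = no λ ()

-- Fixing the first term and leaving the index distance to `Completes` makes the decision take
-- quadratically many tests, with no list indexing.
Double3AP : List ℕ → Set
Double3AP []       = ⊥
Double3AP (x ∷ xs) = Completes x xs xs ⊎ Double3AP xs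

double3AP? : ∀ xs → Dec (Double3AP xs)
double3AP? []       = no λ ()
double3AP? (x ∷ xs) = completes? x xs xs ⊎-dec double3AP? xs

2*-suc-injective : suc m ≡ 2 * suc n → m ≡ suc (2 * n)
2*-suc-injective {n = n} eq = suc-injective (trans eq (*-suc 2 n))

-- Positions start just after `x`, so the distances from `x` are `j + 1` and `k + 1`; doubling the
-- former gives `k = 2j + 1`. Dropping one entry of `ys` and two of `zs` preserves this relation.
lookup⇒Completes : ∀ x ys zs (j : Fin (length ys)) (k : Fin (length zs)) →
                   toℕ k ≡ suc (2 * toℕ j) → x + lookup zs k ≡ 2 * lookup ys j →
                   Completes x ys zs
lookup⇒Completes x (y ∷ ys) (_ ∷ z ∷ zs) zero    (suc zero)    _  eq = inj₁ eq
lookup⇒Completes x (y ∷ ys) (_ ∷ z ∷ zs) (suc j) (suc (suc k)) k≡ eq =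
  inj₂ (lookup⇒Completes x ys zs j k (2*-suc-injective (suc-injective k≡)) eq)

-- Induction on `i`: lowering all three indices by one takes 2 from both sides of the index
-- equation, until it reads `k = 2j`.
HasDouble3AP⇒Double3AP : ∀ xs → HasDouble3AP xs → Double3AP xs
HasDouble3AP⇒Double3AP (x ∷ xs) (zero , suc j , suc k , _ , _ , k≡ , eq) =
  inj₁ (lookup⇒Completes x xs xs j k (2*-suc-injective k≡) eq)
HasDouble3AP⇒Double3AP (x ∷ xs) (suc i , suc j , suc k , s≤s i<j , s≤s j<k , i+k≡ , eq) =
  inj₂ (HasDouble3AP⇒Double3AP xs
    (i , j , k , i<j , j<k , suc-injective (trans (sym (+-suc _ _)) (2*-suc-injective i+k≡)) , eq))

Completes-prefix : ∀ {x ys ys′ zs zs′} → Prefix _≡_ ys ys′ → Prefix _≡_ zs zs′ →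
                   Completes x ys zs → Completes x ys′ zs′
-- In all other cases `ys` is empty or `zs` has fewer than two entries, and `Completes x ys zs`
-- reduces to `⊥`.
Completes-prefix (refl ∷ ps) (_ ∷ refl ∷ qs) = Sum.map₂ (Completes-prefix ps qs)

Double3AP-prefix : ∀ {xs ys} → Prefix _≡_ xs ys → Double3AP xs → Double3AP ys
Double3AP-prefix (refl ∷ ps) = Sum.map (Completes-prefix ps ps) (Double3AP-prefix ps)

tabulate⁺ : {R : REL A B ℓ} {f : Fin m → A} {g : Fin n → B} (m≤n : m ≤ n) →
            (∀ i → R (f i) (g (inject≤ i m≤n))) → Prefix R (tabulate f) (tabulate g)
tabulate⁺ {m = 0}                 m≤n f∼g = []
tabulate⁺ {m = suc _} {n = suc _} m≤n f∼g = f∼g zero ∷ tabulate⁺ (s≤s⁻¹ m≤n) (f∼g ∘ suc)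

restrict : m ≤ n → Coloring r n → Coloring r m
restrict m≤n χ i = χ (inject≤ i m≤n)

-- The indices live in different types `Fin m` and `Fin n`, so they are related along `inject≤`
-- until `element` sends them to equal numbers.
colorClass-restrict : (m≤n : m ≤ n) (χ : Coloring r n) (c : Fin r) →
                      Prefix _≡_ (colorClass (restrict m≤n χ) c) (colorClass χ c)
colorClass-restrict m≤n χ c =
  map⁺ element element
    (Prefix.map (λ { {i} refl → cong suc (sym (toℕ-inject≤ i m≤n)) })
      -- On related indices both filters test the same proposition by the definition of `restrict`.
      (filter⁺ _ _ (λ { refl → id }) (λ { refl → id }) initial))
  where
  initial : Prefix (λ i j → inject≤ i m≤n ≡ j) (allFin _) (allFin _)
  initial = tabulate⁺ m≤n (λ _ → refl)

avoids : ∀ c → ¬ Double3AP (colorClass wordColoring c)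
-- The finite search runs here: `from-yes` typechecks because the decision evaluates to yes.
avoids = from-yes (all? λ c → ¬? (double3AP? (colorClass wordColoring c)))

restrict-avoids : (m≤413 : m ≤ 413) →
                  ¬ HasMonochromaticDouble3AP (restrict m≤413 wordColoring)
restrict-avoids m≤413 (c , ap) =
  avoids c (Double3AP-prefix (colorClass-restrict m≤413 wordColoring c)
    (HasDouble3AP⇒Double3AP _ ap))

theorem2 : (w*[ 3 ,3]≥ 414) × (¬ HasMonochromaticDouble3AP wordColoring)
theorem2 =
  (λ { N (unavoidable , _) → ≮⇒≥ λ N<414 →
       restrict-avoids (s≤s⁻¹ N<414) (unavoidable (restrict (s≤s⁻¹ N<414) wordColoring)) }) ,
  (λ { (c , ap) → avoids c (HasDouble3AP⇒Double3AP _ ap) })
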